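{- Let $F$ be a formula in 2-XNF in the variables $X_1,\dots,X_n$, and let $(L,V,E)$ be an implication graph structure for $F$. (a) For all $f\in V$ and $g\in\Delta_f$, we have $(f+1)g\in I_F$. (b) Let $f,g\in V$. If $\Delta_f\cap(1+\Delta_g)\neq\emptyset$, then $(f+1)(g+1)\in I_F$. (c) For all $f\in V$, we have $\Delta_f\cap\Delta_{f+1}\subseteq I_F$.
   Context: $\mathbb{B}_n=\mathbb{F}_2[X_1,\dots,X_n]/\langle X_1^2-X_1,\dots,X_n^2-X_n\rangle$ is the ring of Boolean polynomials, $x_i$ the residue class of $X_i$, and $\mathbb{L}_n=\langle 1,x_1,\dots,x_n\rangle_{\mathbb{F}_2}$ the space of linear Boolean polynomials. A lineral is an XOR of literals; a formula is in 2-XNF if it is a conjunction of clauses each of which is a disjunction of at most two linerals. For such a formula $F$ in $X_1,\dots,X_n$ (true $=1$, false $=0$), $I_F\subseteq\mathbb{B}_n$ is the unique ideal whose zero set $\mathcal{Z}(I_F)\subseteq\mathbb{F}_2^n$ equals the set of satisfying assignments of $F$. An implication graph structure (IGS) for $F$ is a tuple $(L,V,E)$ with $L,V\subseteq\mathbb{L}_n$ and $E\subseteq V^2$ such that (1) $I_F=\langle L\rangle+\langle fg\mid (f+1,g)\in E\rangle$; (2) for all $(f+1,g)\in E$ we have $(g+1,f)\in E$; (3) for all $f\in V$, $(f,f)\notin E$. A path $f\to g$ is a sequence $f=f_1,\dots,f_s=g$ in $V$ with $(f_i,f_{i+1})\in E$ for $1\le i\le s-1$. The set of descendants of $f$ is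 $D_f=\{f\}\cup\{g\in V\mid \text{there is a path } f\to g \text{ in }(V,E)\}$, and $\Delta_f=\langle D_f\rangle_{\mathbb{F}_2}\subseteq\mathbb{L}_n$ is the space of descendants of $f$. The same formulas define $D_{f+1}$ and $\Delta_{f+1}$ (with $D_{f+1}=\{f+1\}$ if $f+1\notin V$). For a subspace $U\subseteq\mathbb{L}_n$, $1+U=\{u+1\mid u\in U\}$. -}

module Defs where

open import Algebra.Bundles using (CommutativeRing)
import Algebra.Properties.AbelianGroup as AbelianGroupProperties
import Algebra.Properties.Ring as RingProperties
open import Data.Bool.Base using (Bool; true; false; not; _∧_; _xor_)
open import Data.Bool.Properties
  using (∧-assoc; ∧-comm; ∧-identityˡ; ∧-distribʳ-xor; ∧-idem;
         xor-assoc; xor-comm; xor-identityˡ; xor-same)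
open import Data.Fin.Base using (Fin)
open import Data.Bool.ListAction using (all; any)
open import Data.List.Base using (List; map; foldr)
open import Data.Nat.Base using (ℕ)
open import Data.Product.Base using (_×_; _,_; ∃; ∃₂)
open import Data.Sum.Base using (_⊎_)
open import Data.Vec.Base using (Vec; lookup)
open import Data.Vec.Bounded.Base using (Vec≤; toList)
open import Level using (0ℓ; _⊔_)
open import Relation.Binary.Core using (Rel)
open import Relation.Binary.Definitions using (_Respects_; _Respects₂_)
open import Relation.Binary.PropositionalEquality.Core as ≡ using (_≡_)
import Relation.Binary.Reasoning.Setoid as SetoidReasoning
open import Relation.Nullary.Negation.Core using (¬_)
open import Relation.Unary using (Pred; _∈_; _⊆_; _≐_)

module Ideals {c ℓ} (R : CommutativeRing c ℓ) where

  open CommutativeRing R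

  record IsIdeal {p} (I : Pred Carrier p) : Set (c ⊔ ℓ ⊔ p) where
    field
      resp : I Respects _≈_
      0∈   : 0# ∈ I
      +∈   : ∀ {f g} → f ∈ I → g ∈ I → f + g ∈ I
      *∈   : ∀ f {g} → g ∈ I → f * g ∈ I

  data ⟨_⟩ {p} (S : Pred Carrier p) : Pred Carrier (c ⊔ ℓ ⊔ p) where
    incl : ∀ {f} → f ∈ S → f ∈ ⟨ S ⟩
    null : 0# ∈ ⟨ S ⟩
    add  : ∀ {f g} → f ∈ ⟨ S ⟩ → g ∈ ⟨ S ⟩ → f + g ∈ ⟨ S ⟩
    mul  : ∀ f {g} → g ∈ ⟨ S ⟩ → f * g ∈ ⟨ S ⟩
    resp : ∀ {f g} → f ≈ g → f ∈ ⟨ S ⟩ → g ∈ ⟨ S ⟩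

  ⟨⟩-isIdeal : ∀ {p} (S : Pred Carrier p) → IsIdeal ⟨ S ⟩
  ⟨⟩-isIdeal S = record { resp = resp ; 0∈ = null ; +∈ = add ; *∈ = mul }

  infixl 6 _+ᴵ_

  _+ᴵ_ : ∀ {p q} → Pred Carrier p → Pred Carrier q → Pred Carrier (c ⊔ ℓ ⊔ p ⊔ q)
  (I +ᴵ J) h = ∃₂ λ f g → f ∈ I × g ∈ J × h ≈ f + g

-- R / I has the carrier of R; only the equality changes.

module Quotient {c ℓ p} (R : CommutativeRing c ℓ)
                (I : Pred (CommutativeRing.Carrier R) p)
                (isIdeal : Ideals.IsIdeal R I) where

  open CommutativeRing R
  open Ideals.IsIdeal isIdeal
  open AbelianGroupProperties +-abelianGroup using (⁻¹-anti-homo‿-; ⁻¹-∙-comm)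
  open RingProperties ring using (-1*x≈-x; -‿distribʳ-*; x[y-z]≈xy-xz)
  open SetoidReasoning setoid

  infix 4 _≈ᴵ_

  _≈ᴵ_ : Rel Carrier p
  f ≈ᴵ g = f - g ∈ I

  ≈⇒≈ᴵ : ∀ {f g} → f ≈ g → f ≈ᴵ g
  ≈⇒≈ᴵ {f} {g} f≈g = resp (sym (trans (+-congʳ f≈g) (-‿inverseʳ g))) 0∈

  neg∈ : ∀ {f} → f ∈ I → - f ∈ I
  neg∈ {f} f∈I = resp (-1*x≈-x f) (*∈ (- 1#) f∈I)

  ≈ᴵ-sym : ∀ {f g} → f ≈ᴵ g → g ≈ᴵ f
  ≈ᴵ-sym {f} {g} p = resp (⁻¹-anti-homo‿- f g) (neg∈ p)

  ≈ᴵ-trans : ∀ {f g h} → f ≈ᴵ g → g ≈ᴵ h → f ≈ᴵ h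
  ≈ᴵ-trans {f} {g} {h} p q = resp telescope (+∈ p q)
    where
    telescope : (f - g) + (g - h) ≈ f - h
    telescope = begin
      (f + - g) + (g + - h)  ≈⟨ +-assoc f (- g) (g + - h) ⟩
      f + (- g + (g + - h))  ≈⟨ +-congˡ (+-assoc (- g) g (- h)) ⟨
      f + ((- g + g) + - h)  ≈⟨ +-congˡ (+-congʳ (-‿inverseˡ g)) ⟩
      f + (0# + - h)         ≈⟨ +-congˡ (+-identityˡ (- h)) ⟩
      f + - h                ∎

  +-congᴵ : ∀ {f g h k} → f ≈ᴵ g → h ≈ᴵ k → f + h ≈ᴵ g + k
  +-congᴵ {f} {g} {h} {k} p q = resp interchange (+∈ p q)
    where
    interchange : (f - g) + (h - k) ≈ (f + h) - (g + k)
    interchange = begin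
      (f + - g) + (h + - k)  ≈⟨ +-assoc f (- g) (h + - k) ⟩
      f + (- g + (h + - k))  ≈⟨ +-congˡ (+-assoc (- g) h (- k)) ⟨
      f + ((- g + h) + - k)  ≈⟨ +-congˡ (+-congʳ (+-comm (- g) h)) ⟩
      f + ((h + - g) + - k)  ≈⟨ +-congˡ (+-assoc h (- g) (- k)) ⟩
      f + (h + (- g + - k))  ≈⟨ +-assoc f h (- g + - k) ⟨
      (f + h) + (- g + - k)  ≈⟨ +-congˡ (⁻¹-∙-comm g k) ⟩
      (f + h) - (g + k)      ∎

  -‿congᴵ : ∀ {f g} → f ≈ᴵ g → - f ≈ᴵ - g
  -‿congᴵ {f} {g} p = resp (sym (⁻¹-∙-comm f (- g))) (neg∈ p)

  *-congˡᴵ : ∀ {f g h} → g ≈ᴵ h → f * g ≈ᴵ f * h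
  *-congˡᴵ {f} {g} {h} p = resp (x[y-z]≈xy-xz f g h) (*∈ f p)

  *-congᴵ : ∀ {f g h k} → f ≈ᴵ g → h ≈ᴵ k → f * h ≈ᴵ g * k
  *-congᴵ {f} {g} {h} {k} p q =
    ≈ᴵ-trans (*-congˡᴵ q)
      (≈ᴵ-trans (≈⇒≈ᴵ (*-comm f k))
        (≈ᴵ-trans (*-congˡᴵ p) (≈⇒≈ᴵ (*-comm k g))))

  commutativeRing : CommutativeRing c p
  commutativeRing = record
    { Carrier = Carrier
    ; _≈_ = _≈ᴵ_
    ; _+_ = _+_
    ; _*_ = _*_
    ; -_ = -_
    ; 0# = 0#
    ; 1# = 1#
    ; isCommutativeRing = record
      { isRing = record
        { +-isAbelianGroup = record
          { isGroup = record
            { isMonoid = record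
              { isSemigroup = record
                { isMagma = record
                  { isEquivalence = record
                    { refl = ≈⇒≈ᴵ refl ; sym = ≈ᴵ-sym ; trans = ≈ᴵ-trans }
                  ; ∙-cong = +-congᴵ
                  }
                ; assoc = λ f g h → ≈⇒≈ᴵ (+-assoc f g h)
                }
              ; identity = (λ f → ≈⇒≈ᴵ (+-identityˡ f)) , (λ f → ≈⇒≈ᴵ (+-identityʳ f))
              }
            ; inverse = (λ f → ≈⇒≈ᴵ (-‿inverseˡ f)) , (λ f → ≈⇒≈ᴵ (-‿inverseʳ f))
            ; ⁻¹-cong = -‿congᴵ
            }
          ; comm = λ f g → ≈⇒≈ᴵ (+-comm f g)
          }
        ; *-cong = *-congᴵ
        ; *-assoc = λ f g h → ≈⇒≈ᴵ (*-assoc f g h)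
        ; *-identity = (λ f → ≈⇒≈ᴵ (*-identityˡ f)) , (λ f → ≈⇒≈ᴵ (*-identityʳ f))
        ; distrib = (λ f g h → ≈⇒≈ᴵ (distribˡ f g h)) , (λ f g h → ≈⇒≈ᴵ (distribʳ f g h))
        }
      ; *-comm = λ f g → ≈⇒≈ᴵ (*-comm f g)
      }
    }

-- 𝔽₂ is Bool with _xor_ and _∧_.  The polynomial ring 𝔽₂[X₁,…,Xₙ] is the free
-- commutative 𝔽₂-algebra on n generators: terms modulo the least congruence
-- that satisfies the commutative ring axioms and makes con a ring homomorphism.

infixl 6 _⊕_
infixl 7 _⊗_
infix  8 ⊖_

data Poly (n : ℕ) : Set where
  con : Bool → Poly n
  X   : Fin n → Poly n
  _⊕_ : Poly n → Poly n → Poly n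
  _⊗_ : Poly n → Poly n → Poly n
  ⊖_  : Poly n → Poly n

infix 4 _≋_

data _≋_ {n : ℕ} : Rel (Poly n) 0ℓ where
  ≋-refl  : ∀ {p} → p ≋ p
  ≋-sym   : ∀ {p q} → p ≋ q → q ≋ p
  ≋-trans : ∀ {p q r} → p ≋ q → q ≋ r → p ≋ r
  ⊕-cong  : ∀ {p p′ q q′} → p ≋ p′ → q ≋ q′ → p ⊕ q ≋ p′ ⊕ q′
  ⊗-cong  : ∀ {p p′ q q′} → p ≋ p′ → q ≋ q′ → p ⊗ q ≋ p′ ⊗ q′
  ⊖-cong  : ∀ {p p′} → p ≋ p′ → ⊖ p ≋ ⊖ p′
  ⊕-assoc : ∀ p q r → (p ⊕ q) ⊕ r ≋ p ⊕ (q ⊕ r)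
  ⊕-comm  : ∀ p q → p ⊕ q ≋ q ⊕ p
  ⊕-identityˡ : ∀ p → con false ⊕ p ≋ p
  ⊖-inverseˡ  : ∀ p → ⊖ p ⊕ p ≋ con false
  ⊗-assoc : ∀ p q r → (p ⊗ q) ⊗ r ≋ p ⊗ (q ⊗ r)
  ⊗-comm  : ∀ p q → p ⊗ q ≋ q ⊗ p
  ⊗-identityˡ : ∀ p → con true ⊗ p ≋ p
  ⊗-distribʳ-⊕ : ∀ p q r → (q ⊕ r) ⊗ p ≋ (q ⊗ p) ⊕ (r ⊗ p)
  con-⊕ : ∀ a b → con (a xor b) ≋ con a ⊕ con b
  con-⊗ : ∀ a b → con (a ∧ b) ≋ con a ⊗ con b

𝔽₂[X] : ℕ → CommutativeRing 0ℓ 0ℓ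
𝔽₂[X] n = record
  { Carrier = Poly n
  ; _≈_ = _≋_
  ; _+_ = _⊕_
  ; _*_ = _⊗_
  ; -_ = ⊖_
  ; 0# = con false
  ; 1# = con true
  ; isCommutativeRing = record
    { isRing = record
      { +-isAbelianGroup = record
        { isGroup = record
          { isMonoid = record
            { isSemigroup = record
              { isMagma = record
                { isEquivalence = record { refl = ≋-refl ; sym = ≋-sym ; trans = ≋-trans }
                ; ∙-cong = ⊕-cong
                }
              ; assoc = ⊕-assoc
              }
            ; identity = ⊕-identityˡ , (λ p → ≋-trans (⊕-comm _ _) (⊕-identityˡ p))
            }
          ; inverse = ⊖-inverseˡ , (λ p → ≋-trans (⊕-comm _ _) (⊖-inverseˡ p))
          ; ⁻¹-cong = ⊖-cong
          }
        ; comm = ⊕-comm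
        }
      ; *-cong = ⊗-cong
      ; *-assoc = ⊗-assoc
      ; *-identity = ⊗-identityˡ , (λ p → ≋-trans (⊗-comm _ _) (⊗-identityˡ p))
      ; distrib = (λ p q r → ≋-trans (⊗-comm _ _)
                              (≋-trans (⊗-distribʳ-⊕ p q r)
                                (⊕-cong (⊗-comm _ _) (⊗-comm _ _))))
                , ⊗-distribʳ-⊕
      }
    ; *-comm = ⊗-comm
    }
  }

FieldPoly : ∀ n → Pred (Poly n) 0ℓ
FieldPoly n p = ∃ λ i → p ≡ X i * X i - X i
  where open CommutativeRing (𝔽₂[X] n)

𝔹 : ℕ → CommutativeRing 0ℓ 0ℓ
𝔹 n = Quotient.commutativeRing (𝔽₂[X] n) ⟨ FieldPoly n ⟩ (⟨⟩-isIdeal (FieldPoly n))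
  where open Ideals (𝔽₂[X] n)

∣𝔹∣ : ℕ → Set
∣𝔹∣ n = CommutativeRing.Carrier (𝔹 n)

Assignment : ℕ → Set
Assignment n = Vec Bool n

eval : ∀ {n} → Assignment n → Poly n → Bool
eval a (con c) = c
eval a (X i)   = lookup a i
eval a (p ⊕ q) = eval a p xor eval a q
eval a (p ⊗ q) = eval a p ∧ eval a q
eval a (⊖ p)   = eval a p

eval-cong-≋ : ∀ {n} (a : Assignment n) {p q} → p ≋ q → eval a p ≡ eval a q
eval-cong-≋ a ≋-refl = ≡.refl
eval-cong-≋ a (≋-sym e) = ≡.sym (eval-cong-≋ a e)
eval-cong-≋ a (≋-trans e e′) = ≡.trans (eval-cong-≋ a e) (eval-cong-≋ a e′)
eval-cong-≋ a (⊕-cong e e′) = ≡.cong₂ _xor_ (eval-cong-≋ a e) (eval-cong-≋ a e′)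
eval-cong-≋ a (⊗-cong e e′) = ≡.cong₂ _∧_ (eval-cong-≋ a e) (eval-cong-≋ a e′)
eval-cong-≋ a (⊖-cong e) = eval-cong-≋ a e
eval-cong-≋ a (⊕-assoc p q r) = xor-assoc (eval a p) (eval a q) (eval a r)
eval-cong-≋ a (⊕-comm p q) = xor-comm (eval a p) (eval a q)
eval-cong-≋ a (⊕-identityˡ p) = xor-identityˡ (eval a p)
eval-cong-≋ a (⊖-inverseˡ p) = xor-same (eval a p)
eval-cong-≋ a (⊗-assoc p q r) = ∧-assoc (eval a p) (eval a q) (eval a r)
eval-cong-≋ a (⊗-comm p q) = ∧-comm (eval a p) (eval a q)
eval-cong-≋ a (⊗-identityˡ p) = ∧-identityˡ (eval a p)
eval-cong-≋ a (⊗-distribʳ-⊕ p q r) = ∧-distribʳ-xor (eval a p) (eval a q) (eval a r)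
eval-cong-≋ a (con-⊕ b c) = ≡.refl
eval-cong-≋ a (con-⊗ b c) = ≡.refl

-- Evaluation at points of 𝔽₂ⁿ is well defined on 𝔹 n.

eval-cong : ∀ {n} (a : Assignment n) {p q} → CommutativeRing._≈_ (𝔹 n) p q →
            eval a p ≡ eval a q
eval-cong {n} a {p} {q} p≈q = xor-false (eval a p) (eval a q) (vanish p≈q)
  where
  open Ideals (𝔽₂[X] n)

  vanish : ∀ {f} → f ∈ ⟨ FieldPoly n ⟩ → eval a f ≡ false
  vanish (incl (i , ≡.refl)) =
    ≡.trans (≡.cong (_xor lookup a i) (∧-idem (lookup a i))) (xor-same (lookup a i))
  vanish null = ≡.refl
  vanish (add u v) = ≡.cong₂ _xor_ (vanish u) (vanish v)
  vanish (mul f {g} u) = ≡.trans (≡.cong (eval a f ∧_) (vanish u)) (∧-comm (eval a f) false)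
  vanish (resp e u) = ≡.trans (≡.sym (eval-cong-≋ a e)) (vanish u)

  xor-false : ∀ b c → b xor c ≡ false → b ≡ c
  xor-false false false _ = ≡.refl
  xor-false true  true  _ = ≡.refl

𝓩 : ∀ {n} → Pred (∣𝔹∣ n) 0ℓ → Pred (Assignment n) 0ℓ
𝓩 I a = ∀ {f} → f ∈ I → eval a f ≡ false

data Literal (n : ℕ) : Set where
  pos neg : Fin n → Literal n

-- A lineral is the list of literals being XORed.  The empty XOR is the constant
-- false, and so is the empty clause.

Lineral : ℕ → Set
Lineral n = List (Literal n)

Clause : ℕ → Set
Clause n = Vec≤ (Lineral n) 2

2XNF : ℕ → Set
2XNF n = List (Clause n)

⟦_⟧ₗ : ∀ {n} → Literal n → Assignment n → Bool
⟦ pos i ⟧ₗ a = lookup a i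
⟦ neg i ⟧ₗ a = not (lookup a i)

⟦_⟧ₓ : ∀ {n} → Lineral n → Assignment n → Bool
⟦ ℓ ⟧ₓ a = foldr _xor_ false (map (λ l → ⟦ l ⟧ₗ a) ℓ)

⟦_⟧ : ∀ {n} → 2XNF n → Assignment n → Bool
⟦ F ⟧ a = all (λ C → any (λ ℓ → ⟦ ℓ ⟧ₓ a) (toList C)) F

Sat : ∀ {n} → 2XNF n → Pred (Assignment n) 0ℓ
Sat F a = ⟦ F ⟧ a ≡ true

-- I_F is specified by its defining property, the zero set; statements about I_F
-- quantify over IdealOf F.

record IdealOf {n : ℕ} (F : 2XNF n) : Set₁ where
  open Ideals (𝔹 n)
  field
    ideal   : Pred (∣𝔹∣ n) 0ℓ
    isIdeal : IsIdeal ideal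
    zeros   : 𝓩 ideal ≐ Sat F

module _ {n : ℕ} where

  open CommutativeRing (𝔹 n)

  data Span (S : Pred (∣𝔹∣ n) 0ℓ) : Pred (∣𝔹∣ n) 0ℓ where
    incl  : ∀ {f} → f ∈ S → f ∈ Span S
    null  : 0# ∈ Span S
    add   : ∀ {f g} → f ∈ Span S → g ∈ Span S → f + g ∈ Span S
    scale : ∀ (c : Bool) {f} → f ∈ Span S → con c * f ∈ Span S
    resp  : ∀ {f g} → f ≈ g → f ∈ Span S → g ∈ Span S

  1+ : Pred (∣𝔹∣ n) 0ℓ → Pred (∣𝔹∣ n) 0ℓ
  1+ U f = ∃ λ u → u ∈ U × f ≈ u + 1#

𝕃 : ∀ n → Pred (∣𝔹∣ n) 0ℓ
𝕃 n = Span (λ f → f ≈ 1# ⊎ (∃ λ i → f ≈ X i))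
  where open CommutativeRing (𝔹 n)

-- Elements of 𝔹 n are represented by terms, so subsets and relations are
-- required to respect its equality.

record IGS {n : ℕ} (F : 2XNF n) (I_F : IdealOf F) : Set₁ where
  open CommutativeRing (𝔹 n)
  open Ideals (𝔹 n)
  open IdealOf I_F using (ideal)
  field
    L V : Pred (∣𝔹∣ n) 0ℓ
    E   : Rel (∣𝔹∣ n) 0ℓ
    L-resp : L Respects _≈_
    V-resp : V Respects _≈_
    E-resp : E Respects₂ _≈_
    L⊆𝕃  : L ⊆ 𝕃 n
    V⊆𝕃  : V ⊆ 𝕃 n
    E⊆V² : ∀ {f g} → E f g → f ∈ V × g ∈ V
    generates   : ideal ≐ ⟨ L ⟩ +ᴵ ⟨ (λ h → ∃₂ λ f g → E (f + 1#) g × h ≈ f * g) ⟩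
    skew        : ∀ {f g} → E (f + 1#) g → E (g + 1#) f
    irreflexive : ∀ {f} → f ∈ V → ¬ E f f

  data Path : Rel (∣𝔹∣ n) 0ℓ where
    stop : ∀ {f g} → f ∈ V → f ≈ g → Path f g
    step : ∀ {f g h} → f ∈ V → E f g → Path g h → Path f h

  D : ∣𝔹∣ n → Pred (∣𝔹∣ n) 0ℓ
  D f g = g ≈ f ⊎ (g ∈ V × Path f g)

  Δ : ∣𝔹∣ n → Pred (∣𝔹∣ n) 0ℓ
  Δ f = Span (D f)

{-# OPTIONS --safe #-}
-- In a Boolean ring f(f+1) = 0 and f + (f+1) = 1.  Condition (1) gives (f+1)g ∈ I for
-- every edge f → g, and multiplying by 1 = g + (g+1) carries this along paths, so that
-- f+1 multiplies Δ f into I; as Δ (f+1) is spanned by f+1 and ends of paths even when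
-- f+1 ∉ V, likewise f multiplies Δ (f+1) into I.  Parts (b) and (c) then follow from
-- 1 = u + (u+1), with u + 1 ∈ Δ f and u ∈ Δ g in (b), and u = f+1 in (c).
module Submission where

open import Defs
open import Algebra.Bundles using (CommutativeRing)
import Algebra.Properties.CommutativeSemigroup as CommutativeSemigroupProperties
open import Data.Bool.Base using (true; false)
open import Data.Nat.Base using (ℕ)
open import Data.Product.Base using (_×_; _,_; proj₂)
open import Data.Sum.Base using (inj₁; inj₂)
import Relation.Binary.PropositionalEquality.Core as ≡
import Relation.Binary.Reasoning.Setoid as SetoidReasoning
open import Relation.Unary using (Pred; _∈_; _∩_; _⊆_; Satisfiable)

module IdealProperties {c ℓ p} (R : CommutativeRing c ℓ)
                       {I : Pred (CommutativeRing.Carrier R) p}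
                       (isIdeal : Ideals.IsIdeal R I) where

  open CommutativeRing R
  open Ideals.IsIdeal isIdeal using (+∈) renaming (resp to I-resp)

  -- Since `x ≈ s * x + t * x`, membership may be tested after multiplying by each summand of a
  -- decomposition of 1; each use below takes `s` and `t` of the form `p` and `p + 1#`, up to `≈`.
  ∈-by-comaximal : ∀ {s t x} → s + t ≈ 1# → s * x ∈ I → t * x ∈ I → x ∈ I
  ∈-by-comaximal {s} {t} {x} s+t≈1 sx tx = I-resp
    (trans (sym (distribʳ x s t)) (trans (*-congʳ s+t≈1) (*-identityˡ x)))
    (+∈ sx tx)

module _ {n : ℕ} where

  open CommutativeRing (𝔹 n)
  open CommutativeSemigroupProperties +-commutativeSemigroup
    using () renaming (interchange to +-interchange)
  open CommutativeSemigroupProperties *-commutativeSemigroup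
    using () renaming (interchange to *-interchange)
  open SetoidReasoning setoid
  private
    module 𝕀 = Ideals (𝔽₂[X] n)
    module Q = Quotient (𝔽₂[X] n) 𝕀.⟨ FieldPoly n ⟩ (𝕀.⟨⟩-isIdeal (FieldPoly n))

  p+p≈0 : ∀ p → p + p ≈ 0#
  p+p≈0 p = begin
    p + p            ≈⟨ +-cong (*-identityˡ p) (*-identityˡ p) ⟨
    1# * p + 1# * p  ≈⟨ distribʳ p 1# 1# ⟨
    -- Characteristic 2 enters here: `0#` is `con false`, to which `con (true xor true)` computes.
    (1# + 1#) * p    ≈⟨ *-congʳ (Q.≈⇒≈ᴵ (con-⊕ true true)) ⟨
    0# * p           ≈⟨ zeroˡ p ⟩
    0#               ∎

  -p≈p : ∀ p → - p ≈ p
  -p≈p p = begin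
    - p            ≈⟨ +-identityʳ (- p) ⟨
    - p + 0#       ≈⟨ +-congˡ (p+p≈0 p) ⟨
    - p + (p + p)  ≈⟨ +-assoc (- p) p p ⟨
    - p + p + p    ≈⟨ +-congʳ (-‿inverseˡ p) ⟩
    0# + p         ≈⟨ +-identityˡ p ⟩
    p              ∎

  p+[p+1]≈1 : ∀ p → p + (p + 1#) ≈ 1#
  p+[p+1]≈1 p = begin
    p + (p + 1#)  ≈⟨ +-assoc p p 1# ⟨
    p + p + 1#    ≈⟨ +-congʳ (p+p≈0 p) ⟩
    0# + 1#       ≈⟨ +-identityˡ 1# ⟩
    1#            ∎

  p+1+1≈p : ∀ p → p + 1# + 1# ≈ p
  p+1+1≈p p = begin
    p + 1# + 1#    ≈⟨ +-assoc p 1# 1# ⟩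
    p + (1# + 1#)  ≈⟨ +-congˡ (p+p≈0 1#) ⟩
    p + 0#         ≈⟨ +-identityʳ p ⟩
    p              ∎

  -- Induction on the representing term: idempotents are closed under products because the ring is
  -- commutative, and under sums because the cross terms `p * q` cancel in characteristic 2.
  *-idem : ∀ p → p * p ≈ p
  *-idem (con false) = zeroˡ 0#
  *-idem (con true)  = *-identityˡ 1#
  -- Equality in the quotient is membership of the difference in the ideal, and here the difference
  -- is literally a field polynomial.
  *-idem (X i)       = 𝕀.⟨_⟩.incl (i , ≡.refl)
  *-idem (p ⊕ q)     = begin
    (p + q) * (p + q)                  ≈⟨ distribˡ (p + q) p q ⟩
    (p + q) * p + (p + q) * q          ≈⟨ +-cong (distribʳ p p q) (distribʳ q p q) ⟩
    (p * p + q * p) + (p * q + q * q)  ≈⟨ +-congˡ (+-comm (p * q) (q * q)) ⟩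
    (p * p + q * p) + (q * q + p * q)  ≈⟨ +-interchange (p * p) (q * p) (q * q) (p * q) ⟩
    (p * p + q * q) + (q * p + p * q)  ≈⟨ +-congˡ (+-congʳ (*-comm q p)) ⟩
    (p * p + q * q) + (p * q + p * q)  ≈⟨ +-congˡ (p+p≈0 (p * q)) ⟩
    (p * p + q * q) + 0#               ≈⟨ +-identityʳ (p * p + q * q) ⟩
    p * p + q * q                      ≈⟨ +-cong (*-idem p) (*-idem q) ⟩
    p + q                              ∎
  *-idem (p ⊗ q)     = begin
    (p * q) * (p * q)  ≈⟨ *-interchange p q p q ⟩
    (p * p) * (q * q)  ≈⟨ *-cong (*-idem p) (*-idem q) ⟩
    p * q              ∎
  *-idem (⊖ p)       = begin
    - p * - p  ≈⟨ *-cong (-p≈p p) (-p≈p p) ⟩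
    p * p      ≈⟨ *-idem p ⟩
    p          ≈⟨ -p≈p p ⟨
    - p        ∎

  [p+1]*p≈0 : ∀ p → (p + 1#) * p ≈ 0#
  [p+1]*p≈0 p = begin
    (p + 1#) * p    ≈⟨ distribʳ p p 1# ⟩
    p * p + 1# * p  ≈⟨ +-cong (*-idem p) (*-identityˡ p) ⟩
    p + p           ≈⟨ p+p≈0 p ⟩
    0#              ∎

module IGSProperties {n : ℕ} {F : 2XNF n} {I_F : IdealOf F} (G : IGS F I_F) where

  open CommutativeRing (𝔹 n)
  open CommutativeSemigroupProperties *-commutativeSemigroup
    using (x∙yz≈y∙xz; x∙yz≈z∙xy; x∙yz≈z∙yx)
  open IdealOf I_F using (ideal; isIdeal)
  open Ideals.IsIdeal isIdeal
    using (0∈; +∈; *∈) renaming (resp to ideal-resp)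
  open Ideals (𝔹 n) using (module ⟨_⟩)
  open IdealProperties (𝔹 n) isIdeal
  open IGS G

  edge⇒∈ideal : ∀ {f g} → E f g → (f + 1#) * g ∈ ideal
  edge⇒∈ideal {f} {g} e = proj₂ generates
    ( 0# , (f + 1#) * g , ⟨_⟩.null
    -- Condition (1) attaches the product `f′ * g` to the edge from `f′ + 1#` to `g`; taking
    -- `f′ = f + 1#` makes that edge start at `f`. The summand from `L` is 0.
    , ⟨_⟩.incl (f + 1# , g , proj₂ E-resp (sym (p+1+1≈p f)) e , refl)
    , sym (+-identityˡ ((f + 1#) * g)) )

  ≈⇒∈ideal : ∀ {f g} → g ≈ f → (f + 1#) * g ∈ ideal
  ≈⇒∈ideal {f} g≈f = ideal-resp (sym (trans (*-congˡ g≈f) ([p+1]*p≈0 f))) 0∈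

  path⇒∈ideal : ∀ {f g} → Path f g → (f + 1#) * g ∈ ideal
  path⇒∈ideal (stop _ f≈g) = ≈⇒∈ideal (sym f≈g)
  -- Split along the second vertex `g`: `g * ((f + 1#) * h)` is a multiple of the edge product
  -- `(f + 1#) * g`, and `(g + 1#) * ((f + 1#) * h)` is a multiple of `(g + 1#) * h`, which the rest
  -- of the path puts in the ideal.
  path⇒∈ideal {f} {h} (step {g = g} _ e path) = ∈-by-comaximal (p+[p+1]≈1 g)
    (ideal-resp (x∙yz≈z∙yx h (f + 1#) g) (*∈ h (edge⇒∈ideal e)))
    (ideal-resp (x∙yz≈y∙xz (f + 1#) (g + 1#) h) (*∈ (f + 1#) (path⇒∈ideal path)))

  -- The elements that `f + 1#` multiplies into the ideal form a subspace, so it suffices to treat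
  -- the spanning set `D f`.
  Δ⇒∈ideal : ∀ {f g} → g ∈ Δ f → (f + 1#) * g ∈ ideal
  Δ⇒∈ideal (incl (inj₁ g≈f))        = ≈⇒∈ideal g≈f
  Δ⇒∈ideal (incl (inj₂ (_ , path))) = path⇒∈ideal path
  Δ⇒∈ideal {f} null                 = ideal-resp (sym (zeroʳ (f + 1#))) 0∈
  Δ⇒∈ideal {f} (add {g} {h} u v)    =
    ideal-resp (sym (distribˡ (f + 1#) g h)) (+∈ (Δ⇒∈ideal u) (Δ⇒∈ideal v))
  Δ⇒∈ideal {f} (scale c {g} u)      =
    ideal-resp (x∙yz≈y∙xz (con c) (f + 1#) g) (*∈ (con c) (Δ⇒∈ideal u))
  Δ⇒∈ideal (resp g≈h u)             = ideal-resp (*-congˡ g≈h) (Δ⇒∈ideal u)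

  Δ∩1+Δ⇒∈ideal : ∀ {f g} → Satisfiable (Δ f ∩ 1+ (Δ g)) → (f + 1#) * (g + 1#) ∈ ideal
  Δ∩1+Δ⇒∈ideal {f} {g} (h , h∈Δf , u , u∈Δg , h≈u+1) = ∈-by-comaximal
    -- Here 1 is split as `u + h`: the factor `g + 1#` absorbs `u` and the factor `f + 1#` absorbs
    -- `h`.
    (trans (+-congˡ {u} h≈u+1) (p+[p+1]≈1 u))
    (ideal-resp (x∙yz≈z∙xy (f + 1#) (g + 1#) u) (*∈ (f + 1#) (Δ⇒∈ideal u∈Δg)))
    (ideal-resp (x∙yz≈z∙yx (g + 1#) (f + 1#) h) (*∈ (g + 1#) (Δ⇒∈ideal h∈Δf)))

  Δ∩Δ[f+1]⊆ideal : ∀ {f} → Δ f ∩ Δ (f + 1#) ⊆ ideal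
  Δ∩Δ[f+1]⊆ideal {f} (u , v) =
    -- The summands of 1 are `f + 1#` and `f + 1# + 1#`, exactly the multipliers that `Δ⇒∈ideal`
    -- supplies for `Δ f` and `Δ (f + 1#)`.
    ∈-by-comaximal (p+[p+1]≈1 (f + 1#)) (Δ⇒∈ideal u) (Δ⇒∈ideal v)

proposition4p10 : ∀ {n : ℕ} (F : 2XNF n) (I_F : IdealOf F) (G : IGS F I_F) →
    let open CommutativeRing (𝔹 n)
        open IdealOf I_F using (ideal)
        open IGS G
    in (∀ {f g} → f ∈ V → g ∈ Δ f → (f + 1#) * g ∈ ideal)
     × (∀ {f g} → f ∈ V → g ∈ V → Satisfiable (Δ f ∩ 1+ (Δ g)) → (f + 1#) * (g + 1#) ∈ ideal)
     × (∀ {f} → f ∈ V → Δ f ∩ Δ (f + 1#) ⊆ ideal)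
proposition4p10 F I_F G =
  (λ _ → Δ⇒∈ideal) , (λ _ _ → Δ∩1+Δ⇒∈ideal) , (λ _ → Δ∩Δ[f+1]⊆ideal)
  where open IGSProperties G
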